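{- Let $m$ be an integer with $3\le m\le 6$. Then for every integer $n\ge m-1$, $$F_{n+2,2}\equiv F_{n,2}\pmod{2^m},$$ i.e. from the term of index $m-1$ onward the sequence $(F_{n,2}\bmod 2^m)_{n\ge0}$ is periodic with period $2$.
   Context: For positive integers $r\le m\le n$, $S_r(n,m)$ denotes the $r$-Stirling number of the second kind: the number of partitions of $\{1,\dots,n\}$ into $m$ non-empty blocks such that $1,\dots,r$ lie in pairwise distinct blocks. For a positive integer $r$ and integer $n\ge 0$, the $r$-Fubini number is $F_{n,r}=\sum_{k=0}^{n}(k+r)!\,S_r(n+r,k+r)$. -}

module Defs where

open import Data.Nat using (ℕ; zero; suc; _+_; _*_; _<_; _<?_; _!)
open import Data.Integer as ℤ using (+_)
open import Data.Integer.Divisibility as ℤ using ()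
open import Data.Fin using (Fin; toℕ)
import Data.Fin.Properties as Fin
open import Data.Fin.Subset using (Subset; inside; outside; _∈_; _∩_; Nonempty; Empty)
open import Data.Fin.Subset.Properties using (_∈?_; nonempty?)
open import Data.List using (List; []; _∷_; [_]; _++_; map; filter; length; upTo)
open import Data.Nat.ListAction using (sum)
open import Data.List.Relation.Unary.All as All using (All)
open import Data.List.Relation.Unary.Any as Any using (Any)
open import Data.List.Relation.Unary.AllPairs as AllPairs using (AllPairs)
open import Data.Product using (_×_)
open import Data.Vec using ([]; _∷_)
open import Relation.Binary.PropositionalEquality using (_≡_)
open import Relation.Nullary using (Dec; ¬?; _×-dec_; _→-dec_)

subsets : ∀ n → List (Subset n)
subsets zero    = [ [] ]
subsets (suc n) = map (outside ∷_) (subsets n) ++ map (inside ∷_) (subsets n)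

-- The sublists of length k.  For a list without repetitions, every k-element
-- set of its entries occurs exactly once.
choose : ∀ {A : Set} → ℕ → List A → List (List A)
choose zero    xs       = [ [] ]
choose (suc k) []       = []
choose (suc k) (x ∷ xs) = map (x ∷_) (choose k xs) ++ choose (suc k) xs

IsPartition : ∀ {n} → List (Subset n) → Set
IsPartition π =
    All Nonempty π
  × AllPairs (λ p q → Empty (p ∩ q)) π
  × (∀ i → Any (i ∈_) π)

isPartition? : ∀ {n} (π : List (Subset n)) → Dec (IsPartition π)
isPartition? π =
        All.all? nonempty? π
  ×-dec AllPairs.allPairs? (λ p q → ¬? (nonempty? (p ∩ q))) π
  ×-dec Fin.all? (λ i → Any.any? (i ∈?_) π)

-- The set {1,…,n} is modelled by Fin n, with i + 1 corresponding to the index i;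
-- thus 1,…,r are the indices below r.  In a partition they lie in pairwise
-- distinct blocks iff no block contains two different ones.
Separates : ∀ {n} → ℕ → List (Subset n) → Set
Separates r π = All (λ p → ∀ i j → toℕ i < r → toℕ j < r → i ∈ p → j ∈ p → i ≡ j) π

separates? : ∀ {n} r (π : List (Subset n)) → Dec (Separates r π)
separates? r = All.all? λ p → Fin.all? λ i → Fin.all? λ j →
  (toℕ i <? r) →-dec (toℕ j <? r) →-dec (i ∈? p) →-dec (j ∈? p) →-dec (i Fin.≟ j)

-- S r n m is S_r(n,m): the m-element sets of subsets of Fin n are enumerated
-- without repetition, and those that are admissible partitions are counted.
S : ℕ → ℕ → ℕ → ℕ
S r n m = length (filter (λ π → isPartition? π ×-dec separates? r π) (choose m (subsets n)))

-- F n r is F_{n,r}; the sum runs over k = 0,…,n.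
F : ℕ → ℕ → ℕ
F n r = sum (map (λ k → (k + r) ! * S r (n + r) (k + r)) (upTo (suc n)))

infix 4 _≡_[mod_]
_≡_[mod_] : ℕ → ℕ → ℕ → Set
a ≡ b [mod d ] = (+ d) ℤ.∣ (+ a ℤ.- + b)

{-# OPTIONS --safe #-}
-- Let 0 be the least element.  Removing it from its block in an (r+1)-separated partition of
-- n + 1 points leaves an r-separated partition of n points, possibly with one marked block
-- free of separated points.  For r = 0, 1 this yields the recurrences of S₀ and expresses S₂
-- through S₀, whence a(n,k) = (k+2)! S₂(n+2,k+2) satisfies
-- a(n+1,k+1) = (k+3)(a(n,k) + a(n,k+1)).  Since 64 ∣ 8!, only k < 6 matters modulo 64, and
-- (a(n,0),…,a(n,5)) mod 64 has period 8 from n = 5 on, so finitely many n remain to be checked.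
module Submission where

open import Defs
open import Algebra.Properties.CommutativeSemigroup using (interchange)
open import Data.Bool using (if_then_else_; true; false)
open import Data.Empty using (⊥-elim)
open import Data.Fin using (Fin; zero; suc; toℕ)
import Data.Fin.Properties as Fin
open import Data.Fin.Subset using (Subset; inside; outside; _∈_; _∉_; _∩_; Nonempty; Empty; ⊥)
open import Data.Fin.Subset.Properties using (_∈?_; drop-there; drop-∷-Empty; ∩-comm; x∈p∩q⁺; x∈p∩q⁻; ∉⊥)
open import Data.Integer as ℤ using () renaming (+_ to pos)
open import Data.Integer.Divisibility.Signed using (divides; ∣⇒∣ᵤ)
import Data.Integer.Properties as ℤ
import Data.Integer.Tactic.RingSolver as ℤ
open import Data.List using (List; []; _∷_; [_]; _++_; map; filter; length; upTo; applyUpTo)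
open import Data.List.Membership.Propositional using () renaming (_∈_ to _∈ˡ_)
open import Data.List.Properties using (map-++; map-∘; map-upTo; map-cong)
open import Data.List.Relation.Binary.Permutation.Propositional using (_↭_; refl; prep; swap; trans; ↭-sym)
open import Data.List.Relation.Binary.Permutation.Propositional.Properties using (All-resp-↭; Any-resp-↭; ∷↭∷ʳ)
open import Data.List.Relation.Unary.All as All using (All; []; _∷_)
import Data.List.Relation.Unary.All.Properties as All
open import Data.List.Relation.Unary.AllPairs as AllPairs using (AllPairs; []; _∷_)
import Data.List.Relation.Unary.AllPairs.Properties as AllPairs
open import Data.List.Relation.Unary.Any as Any using (Any; here; there)
import Data.List.Relation.Unary.Any.Properties as Any
open import Data.Nat using (ℕ; zero; suc; _+_; _*_; _∸_; _^_; _!; _/_; _%_; _≤_; _<_; _<?_; _≟_; s≤s; s<s; z<s; s<s⁻¹; NonZero)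
open import Data.Nat.Divisibility using (_∣_; _∣?_; _∣0; 0∣⇒≡0; ∣-trans; ∣m⇒∣m*n; m∣m*n; ∣m∣n⇒∣m+n; m≤n⇒m!∣n!)
open import Data.Nat.DivMod using (m≡m%n+[m/n]*n; m%n<n; %-distribˡ-+; %-distribˡ-*; %-remove-+ʳ; m∣n⇒o%n%m≡o%m)
open import Data.Nat.ListAction using (sum)
open import Data.Nat.ListAction.Properties using (sum-++)
open import Data.Nat.Properties hiding (_≟_; _<?_)
open import Data.Nat.Tactic.RingSolver using (solve-∀)
open import Data.Product using (_×_; _,_; proj₁; uncurry; map₂)
open import Data.Sum using ([_,_]′)
open import Data.Vec using ([]; _∷_; here; there)
open import Function using (_∘_; _⇔_; mk⇔)
open import Function.Construct.Composition using (_⇔-∘_)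
open import Relation.Binary using (Symmetric)
open import Relation.Binary.PropositionalEquality as ≡ using (_≡_; refl; cong; cong₂; sym; subst; module ≡-Reasoning)
open import Relation.Nullary using (Dec; yes; no; does; ¬_; ¬?; _×-dec_; _→-dec_)
open import Relation.Nullary.Decidable using (does-⇔; dec-true; dec-false; from-yes)
open ≡-Reasoning

private
  variable
    A B C : Set
    n k r : ℕ

-- Finite sums and indicators

∑ : List A → (A → ℕ) → ℕ
∑ xs f = sum (map f xs)

∑-++ : ∀ (xs ys : List A) f → ∑ (xs ++ ys) f ≡ ∑ xs f + ∑ ys f
∑-++ xs ys f = ≡.trans (cong sum (map-++ f xs ys)) (sum-++ (map f xs) (map f ys))

∑-map : ∀ (g : A → B) xs f → ∑ (map g xs) f ≡ ∑ xs (f ∘ g)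
∑-map g xs f = cong sum (sym (map-∘ xs))

∑-cong-All : ∀ {xs : List A} {f g} → All (λ x → f x ≡ g x) xs → ∑ xs f ≡ ∑ xs g
∑-cong-All []         = refl
∑-cong-All (eq ∷ eqs) = cong₂ _+_ eq (∑-cong-All eqs)

∑-cong : ∀ (xs : List A) {f g} → (∀ x → f x ≡ g x) → ∑ xs f ≡ ∑ xs g
∑-cong xs eq = ∑-cong-All (All.universal eq xs)

∑-+ : ∀ (xs : List A) f g → ∑ xs (λ x → f x + g x) ≡ ∑ xs f + ∑ xs g
∑-+ []       f g = refl
∑-+ (x ∷ xs) f g = ≡.trans (cong (f x + g x +_) (∑-+ xs f g))
  (interchange +-commutativeSemigroup (f x) (g x) _ _)

∑-*ˡ : ∀ c (xs : List A) f → ∑ xs (λ x → c * f x) ≡ c * ∑ xs f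
∑-*ˡ c []       f = sym (*-zeroʳ c)
∑-*ˡ c (x ∷ xs) f = ≡.trans (cong (c * f x +_) (∑-*ˡ c xs f)) (sym (*-distribˡ-+ c (f x) _))

∑-0 : ∀ (xs : List A) {f} → (∀ x → f x ≡ 0) → ∑ xs f ≡ 0
∑-0 []       eq = refl
∑-0 (x ∷ xs) eq = cong₂ _+_ (eq x) (∑-0 xs eq)

𝟙 : {P : Set} → Dec P → ℕ
𝟙 P? = if does P? then 1 else 0

𝟙-⇔ : {P Q : Set} → P ⇔ Q → (P? : Dec P) (Q? : Dec Q) → 𝟙 P? ≡ 𝟙 Q?
𝟙-⇔ eq P? Q? = cong (if_then 1 else 0) (does-⇔ eq P? Q?)

𝟙-true : {P : Set} (P? : Dec P) → P → 𝟙 P? ≡ 1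
𝟙-true P? p = cong (if_then 1 else 0) (dec-true P? p)

𝟙-false : {P : Set} (P? : Dec P) → ¬ P → 𝟙 P? ≡ 0
𝟙-false P? ¬p = cong (if_then 1 else 0) (dec-false P? ¬p)

𝟙-× : {P Q : Set} (P? : Dec P) (Q? : Dec Q) → 𝟙 (P? ×-dec Q?) ≡ 𝟙 P? * 𝟙 Q?
𝟙-× P? Q? with does P?
... | true  = sym (+-identityʳ _)
... | false = refl

-- The indicator vanishes outside `P`, so the equation is needed only under `P`. This lets block
-- counts be known for admissible partitions alone.
𝟙-* : {P : Set} (P? : Dec P) {a c : ℕ} → (P → a ≡ c) → 𝟙 P? * a ≡ c * 𝟙 P?
𝟙-* (yes p) {a} eq = ≡.trans (*-comm 1 a) (cong (_* 1) (eq p))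
𝟙-* (no _)  {c = c} eq = sym (*-zeroʳ c)

length-filter-∑ : {P : A → Set} (P? : ∀ x → Dec (P x)) (xs : List A) →
                  length (filter P? xs) ≡ ∑ xs (𝟙 ∘ P?)
length-filter-∑ P? []       = refl
length-filter-∑ P? (x ∷ xs) with does (P? x)
... | true  = cong suc (length-filter-∑ P? xs)
... | false = length-filter-∑ P? xs

-- Sums over sublists

∑-choose-∷ : ∀ k (x : A) xs f →
  ∑ (choose (suc k) (x ∷ xs)) f ≡ ∑ (choose k xs) (f ∘ (x ∷_)) + ∑ (choose (suc k) xs) f
∑-choose-∷ k x xs f =
  ≡.trans (∑-++ (map (x ∷_) (choose k xs)) _ f) (cong (_+ _) (∑-map (x ∷_) (choose k xs) f))

length-choose : ∀ k (xs : List A) → All (λ π → length π ≡ k) (choose k xs)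
length-choose zero    xs       = refl ∷ []
length-choose (suc k) []       = []
length-choose (suc k) (x ∷ xs) =
  All.++⁺ (All.map⁺ (All.map (cong suc) (length-choose k xs))) (length-choose (suc k) xs)

∑-choose-map-0 : ∀ k (h : A → B) xs f → (∀ x π → f (h x ∷ π) ≡ 0) →
                 ∑ (choose (suc k) (map h xs)) f ≡ 0
∑-choose-map-0 k h []       f f0 = refl
∑-choose-map-0 k h (x ∷ xs) f f0 = ≡.trans (∑-choose-∷ k (h x) (map h xs) f)
  (cong₂ _+_ (∑-0 (choose k (map h xs)) (f0 x)) (∑-choose-map-0 k h xs f f0))

∑-choose-map-0₂ : ∀ k (h : A → B) xs f → (∀ x y π → f (h x ∷ h y ∷ π) ≡ 0) →
                  ∑ (choose (2 + k) (map h xs)) f ≡ 0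
∑-choose-map-0₂ k h []       f f0 = refl
∑-choose-map-0₂ k h (x ∷ xs) f f0 = ≡.trans (∑-choose-∷ (suc k) (h x) (map h xs) f)
  (cong₂ _+_ (∑-choose-map-0 k h xs (f ∘ (h x ∷_)) (f0 x)) (∑-choose-map-0₂ k h xs f f0))

∑-choose-1 : ∀ (xs : List A) f → ∑ (choose 1 xs) f ≡ ∑ xs (f ∘ [_])
∑-choose-1 []       f = refl
∑-choose-1 (x ∷ xs) f = cong (f [ x ] +_) (∑-choose-1 xs f)

-- The hypotheses say that f is supported on the sublists with exactly one entry from map h ys.
∑-choose-split : ∀ k (g : A → C) (h : B → C) xs ys f →
  (∀ π → f (map g π) ≡ 0) →
  (∀ π x y ρ → f (map g π ++ h x ∷ h y ∷ ρ) ≡ 0) →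
  ∑ (choose (suc k) (map g xs ++ map h ys)) f ≡
  ∑ (choose k xs) (λ π → ∑ ys (λ y → f (map g π ++ [ h y ])))
∑-choose-split zero g h [] ys f f0 f2 = begin
  ∑ (choose 1 (map h ys)) f     ≡⟨ ∑-choose-1 (map h ys) f ⟩
  ∑ (map h ys) (f ∘ [_])        ≡⟨ ∑-map h ys (f ∘ [_]) ⟩
  ∑ ys (λ y → f [ h y ])        ≡⟨ +-identityʳ _ ⟨
  ∑ ys (λ y → f [ h y ]) + 0    ∎
∑-choose-split (suc k) g h [] ys f f0 f2 = ∑-choose-map-0₂ k h ys f (f2 [])
∑-choose-split zero g h (x ∷ xs) ys f f0 f2 = begin
  ∑ (choose 1 (g x ∷ map g xs ++ map h ys)) f
    ≡⟨ cong (_+ ∑ (choose 1 (map g xs ++ map h ys)) f) (f0 [ x ]) ⟩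
  ∑ (choose 1 (map g xs ++ map h ys)) f
    ≡⟨ ∑-choose-split zero g h xs ys f f0 f2 ⟩
  ∑ ys (λ y → f [ h y ]) + 0 ∎
∑-choose-split (suc k) g h (x ∷ xs) ys f f0 f2 = begin
  ∑ (choose (2 + k) (g x ∷ zs)) f
    ≡⟨ ∑-choose-∷ (suc k) (g x) zs f ⟩
  ∑ (choose (suc k) zs) (f ∘ (g x ∷_)) + ∑ (choose (2 + k) zs) f
    ≡⟨ cong₂ _+_
         -- Both hypotheses hold for arbitrary `map g π`, so they survive prefixing `g x`.
         (∑-choose-split k g h xs ys (f ∘ (g x ∷_)) (f0 ∘ (x ∷_)) (f2 ∘ (x ∷_)))
         (∑-choose-split (suc k) g h xs ys f f0 f2) ⟩
  ∑ (choose k xs) (F′ ∘ (x ∷_)) + ∑ (choose (suc k) xs) F′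
    ≡⟨ ∑-choose-∷ k x xs F′ ⟨
  ∑ (choose (suc k) (x ∷ xs)) F′ ∎
  where
  zs = map g xs ++ map h ys
  F′ = λ π → ∑ ys (λ y → f (map g π ++ [ h y ]))

-- Sublists with a marked entry

picks : List A → List (A × List A)
picks []       = []
picks (x ∷ xs) = (x , xs) ∷ map (map₂ (x ∷_)) (picks xs)

∑-picks-proj₁ : ∀ (xs : List A) f → ∑ (picks xs) (f ∘ proj₁) ≡ ∑ xs f
∑-picks-proj₁ []       f = refl
∑-picks-proj₁ (x ∷ xs) f = cong (f x +_)
  (≡.trans (∑-map (map₂ (x ∷_)) (picks xs) (f ∘ proj₁)) (∑-picks-proj₁ xs f))

picks-↭ : ∀ (xs : List A) → All (λ (y , ys) → y ∷ ys ↭ xs) (picks xs)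
picks-↭ []       = []
picks-↭ (x ∷ xs) =
  refl ∷ All.map⁺ (All.map (λ p → trans (swap _ _ refl) (prep x p)) (picks-↭ xs))

-- Double counting: a `k`-sublist with a further entry `y` outside it is a `suc k`-sublist with `y`
-- marked. The hypothesis discards the pairs in which `y` already occurs in `π`.
∑-choose-picks : ∀ k (xs : List A) (g : A → List A → ℕ) →
  (∀ y π → y ∈ˡ π → g y π ≡ 0) →
  ∑ (choose k xs) (λ π → ∑ xs (λ y → g y π)) ≡
  ∑ (choose (suc k) xs) (λ π → ∑ (picks π) (uncurry g))
∑-choose-picks zero    [] g g0 = refl
∑-choose-picks (suc k) [] g g0 = refl
∑-choose-picks k (x ∷ xs) g g0 = begin
  ∑ (choose k (x ∷ xs)) (λ π → ∑ (x ∷ xs) (λ y → g y π))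
    ≡⟨ ∑-+ (choose k (x ∷ xs)) (g x) G ⟩
  ∑ (choose k (x ∷ xs)) (g x) + ∑ (choose k (x ∷ xs)) G
    -- The first sum has `y` equal to `x`, and `g0` removes the sublists that start with `x`. In the
    -- second `y` comes from `xs`, and induction applies both to sublists with the leading `x` and
    -- to those without it.
    ≡⟨ cong₂ _+_ (marked k) (unmarked k) ⟩
  ∑ (choose k xs) (g x) +
    (∑ (choose k xs) (λ π → ∑ (picks π) (uncurry g′)) + ∑ (choose (suc k) xs) H)
    ≡⟨ +-assoc (∑ (choose k xs) (g x)) _ _ ⟨
  ∑ (choose k xs) (g x) + ∑ (choose k xs) (λ π → ∑ (picks π) (uncurry g′))
    + ∑ (choose (suc k) xs) H
    ≡⟨ cong (_+ ∑ (choose (suc k) xs) H) (∑-+ (choose k xs) (g x) _) ⟨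
  ∑ (choose k xs) (λ π → g x π + ∑ (picks π) (uncurry g′)) + ∑ (choose (suc k) xs) H
    ≡⟨ cong (_+ ∑ (choose (suc k) xs) H) (∑-cong (choose k xs) λ π →
         cong (g x π +_) (∑-map (map₂ (x ∷_)) (picks π) (uncurry g))) ⟨
  ∑ (choose k xs) (H ∘ (x ∷_)) + ∑ (choose (suc k) xs) H
    ≡⟨ ∑-choose-∷ k x xs H ⟨
  ∑ (choose (suc k) (x ∷ xs)) H ∎
  where
  g′ = λ y π → g y (x ∷ π)
  G  = λ π → ∑ xs (λ y → g y π)
  H  = λ π → ∑ (picks π) (uncurry g)

  marked : ∀ k → ∑ (choose k (x ∷ xs)) (g x) ≡ ∑ (choose k xs) (g x)
  marked zero    = refl
  marked (suc k) = ≡.trans (∑-choose-∷ k x xs (g x))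
    (cong (_+ ∑ (choose (suc k) xs) (g x)) (∑-0 (choose k xs) λ π → g0 x (x ∷ π) (here refl)))

  unmarked : ∀ k → ∑ (choose k (x ∷ xs)) G ≡
    ∑ (choose k xs) (λ π → ∑ (picks π) (uncurry g′)) + ∑ (choose (suc k) xs) H
  unmarked zero    = ∑-choose-picks zero xs g g0
  unmarked (suc k) = ≡.trans (∑-choose-∷ k x xs G) (cong₂ _+_
    (∑-choose-picks k xs g′ (λ y π y∈π → g0 y (x ∷ π) (there y∈π)))
    (∑-choose-picks (suc k) xs g g0))

-- Sums over all subsets

∑-subsets-suc : ∀ n f → ∑ (subsets (suc n)) f ≡
  ∑ (subsets n) (f ∘ (outside ∷_)) + ∑ (subsets n) (f ∘ (inside ∷_))
∑-subsets-suc n f = ≡.trans (∑-++ (map (outside ∷_) (subsets n)) _ f)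
  (cong₂ _+_ (∑-map (outside ∷_) (subsets n) f) (∑-map (inside ∷_) (subsets n) f))

-- In the recurrence `⊥` stands for 0 forming a block by itself, which leaves no block to mark, so
-- this one term has to be split off.
∑-subsets-⊥ : ∀ n f g → (∀ p → Nonempty p → f p ≡ g p) → (∀ p → Empty p → g p ≡ 0) →
              ∑ (subsets n) f ≡ f ⊥ + ∑ (subsets n) g
∑-subsets-⊥ zero f g f≡g g0 =
  cong (f [] +_) (sym (≡.trans (+-identityʳ _) (g0 [] λ ())))
∑-subsets-⊥ (suc n) f g f≡g g0 = begin
  ∑ (subsets (suc n)) f
    ≡⟨ ∑-subsets-suc n f ⟩
  ∑ (subsets n) (f ∘ (outside ∷_)) + ∑ (subsets n) (f ∘ (inside ∷_))
    ≡⟨ cong₂ _+_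
         (∑-subsets-⊥ n (f ∘ (outside ∷_)) (g ∘ (outside ∷_))
           (λ p (i , i∈p) → f≡g _ (suc i , there i∈p))
           (λ p ¬p → g0 _ λ { (suc i , there i∈p) → ¬p (i , i∈p) }))
         (∑-cong (subsets n) λ p → f≡g _ (zero , here)) ⟩
  f ⊥ + ∑ (subsets n) (g ∘ (outside ∷_)) + ∑ (subsets n) (g ∘ (inside ∷_))
    ≡⟨ +-assoc (f ⊥) _ _ ⟩
  f ⊥ + (∑ (subsets n) (g ∘ (outside ∷_)) + ∑ (subsets n) (g ∘ (inside ∷_)))
    ≡⟨ cong (f ⊥ +_) (∑-subsets-suc n g) ⟨
  f ⊥ + ∑ (subsets (suc n)) g ∎

-- Admissible partitions

Disjoint : Subset n → Subset n → Set
Disjoint p q = Empty (p ∩ q)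

Disjoint-sym : Symmetric (Disjoint {n})
Disjoint-sym {x = p} {q} = subst Empty (∩-comm p q)

Admissible : ℕ → List (Subset n) → Set
Admissible r π = IsPartition π × Separates r π

admissible? : ∀ r (π : List (Subset n)) → Dec (Admissible r π)
admissible? r π = isPartition? π ×-dec separates? r π

-- The free blocks are those that a new separated point may join.
Free : ℕ → Subset n → Set
Free r p = ∀ i → toℕ i < r → i ∉ p

free? : ∀ r (p : Subset n) → Dec (Free r p)
free? r p = Fin.all? λ i → (toℕ i <? r) →-dec ¬? (i ∈? p)

AllPairs-resp-↭ : {R : A → A → Set} → Symmetric R → ∀ {xs ys} → xs ↭ ys →
                  AllPairs R xs → AllPairs R ys
AllPairs-resp-↭ s refl          rs                       = rs
AllPairs-resp-↭ s (prep x p)    (r ∷ rs)                 = All-resp-↭ p r ∷ AllPairs-resp-↭ s p rs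
AllPairs-resp-↭ s (swap x y p) ((rxy ∷ rx) ∷ ry ∷ rs) =
  (s rxy ∷ All-resp-↭ p ry) ∷ All-resp-↭ p rx ∷ AllPairs-resp-↭ s p rs
AllPairs-resp-↭ s (trans p q)   rs                       = AllPairs-resp-↭ s q (AllPairs-resp-↭ s p rs)

Admissible-resp-↭ : {π ρ : List (Subset n)} → π ↭ ρ → Admissible r π → Admissible r ρ
Admissible-resp-↭ p ((ne , dj , cov) , sep) =
  (All-resp-↭ p ne , AllPairs-resp-↭ Disjoint-sym p dj , Any-resp-↭ p ∘ cov) , All-resp-↭ p sep

Admissible-↭ : {π ρ : List (Subset n)} → π ↭ ρ → Admissible r π ⇔ Admissible r ρ
Admissible-↭ p = mk⇔ (Admissible-resp-↭ p) (Admissible-resp-↭ (↭-sym p))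

-- π completed by q, with q allowed to be empty.
Completes : ℕ → Subset n → List (Subset n) → Set
Completes r q π =
    (All Nonempty π × AllPairs Disjoint (q ∷ π) × (∀ i → Any (i ∈_) (q ∷ π)))
  × Separates r π × Free r q

Nonempty-out⁺ : {p : Subset n} → Nonempty p → Nonempty (outside ∷ p)
Nonempty-out⁺ (i , i∈p) = suc i , there i∈p

Nonempty-out⁻ : {p : Subset n} → Nonempty (outside ∷ p) → Nonempty p
Nonempty-out⁻ (suc i , there i∈p) = i , i∈p

-- Deleting 0 shifts every index down, so the first `suc r` points become the first `r`. Since 0 is
-- itself separated, the rest `q` of its block contains no other separated point, whence `Free r q`.
Admissible-∷⇒ : ∀ {q : Subset n} {π} →
  Admissible (suc r) ((inside ∷ q) ∷ map (outside ∷_) π) → Completes r q π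
Admissible-∷⇒ {r = r} {q} {π} ((_ ∷ ne , dq ∷ dj , cov) , sq ∷ sep) =
  ( All.map Nonempty-out⁻ (All.map⁻ ne)
  , All.map drop-∷-Empty (All.map⁻ dq) ∷ AllPairs.map drop-∷-Empty (AllPairs.map⁻ dj)
  , cover ∘ cov ∘ suc )
  , All.map (λ s i j i<r j<r i∈p j∈p →
      Fin.suc-injective (s (suc i) (suc j) (s<s i<r) (s<s j<r) (there i∈p) (there j∈p)))
      (All.map⁻ sep)
  , λ i i<r i∈q → Fin.0≢1+n (sq zero (suc i) z<s (s<s i<r) here (there i∈q))
  where
  cover : ∀ {i} → Any (suc i ∈_) ((inside ∷ q) ∷ map (outside ∷_) π) → Any (i ∈_) (q ∷ π)
  cover (here i∈q) = here (drop-there i∈q)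
  cover (there i∈) = there (Any.map drop-there (Any.map⁻ i∈))

⇒Admissible-∷ : ∀ {q : Subset n} {π} → Completes r q π →
  Admissible (suc r) ((inside ∷ q) ∷ map (outside ∷_) π)
⇒Admissible-∷ {r = r} {q} {π} ((ne , dq ∷ dj , cov) , sep , free) =
  ( (zero , here) ∷ All.map⁺ (All.map Nonempty-out⁺ ne)
  , All.map⁺ (All.map (_∘ Nonempty-out⁻) dq) ∷ AllPairs.map⁺ (AllPairs.map (_∘ Nonempty-out⁻) dj)
  , cover )
  , sepIn ∷ All.map⁺ (All.map sepOut sep)
  where
  cover : ∀ i → Any (i ∈_) ((inside ∷ q) ∷ map (outside ∷_) π)
  cover zero    = here here
  cover (suc i) with cov i
  ... | here i∈q = here (there i∈q)
  ... | there i∈ = there (Any.map⁺ (Any.map there i∈))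

  sepIn : ∀ i j → toℕ i < suc r → toℕ j < suc r → i ∈ inside ∷ q → j ∈ inside ∷ q → i ≡ j
  sepIn zero    zero    _   _   _           _           = refl
  sepIn zero    (suc j) _   j<r _           (there j∈q) = ⊥-elim (free j (s<s⁻¹ j<r) j∈q)
  sepIn (suc i) _       i<r _   (there i∈q) _           = ⊥-elim (free i (s<s⁻¹ i<r) i∈q)

  sepOut : ∀ {p} → (∀ i j → toℕ i < r → toℕ j < r → i ∈ p → j ∈ p → i ≡ j) →
           ∀ i j → toℕ i < suc r → toℕ j < suc r → i ∈ outside ∷ p → j ∈ outside ∷ p → i ≡ j
  sepOut s (suc i) (suc j) i<r j<r (there i∈p) (there j∈p) =
    cong suc (s i j (s<s⁻¹ i<r) (s<s⁻¹ j<r) i∈p j∈p)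

-- `subsets` lists the sets avoiding 0 before those containing it, so the block of 0 comes last in
-- an enumerated partition; a permutation moves it to the front.
Admissible-++ : ∀ (q : Subset n) π →
  Admissible (suc r) (map (outside ∷_) π ++ [ inside ∷ q ]) ⇔ Completes r q π
Admissible-++ q π = mk⇔
  (Admissible-∷⇒ ∘ Admissible-resp-↭ (↭-sym (∷↭∷ʳ (inside ∷ q) (map (outside ∷_) π))))
  (Admissible-resp-↭ (∷↭∷ʳ (inside ∷ q) (map (outside ∷_) π)) ∘ ⇒Admissible-∷)

Completes-⊥ : ∀ (π : List (Subset n)) → Completes r ⊥ π ⇔ Admissible r π
Completes-⊥ {n = n} π = mk⇔
  (λ { ((ne , _ ∷ dj , cov) , sep , _) → (ne , dj , Any.tail ∉⊥ ∘ cov) , sep })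
  (λ { ((ne , dj , cov) , sep) →
       (ne , All.universal ⊥-disjoint π ∷ dj , there ∘ cov) , sep , λ _ _ → ∉⊥ })
  where
  ⊥-disjoint : ∀ (p : Subset n) → Disjoint ⊥ p
  ⊥-disjoint p (i , i∈) = ∉⊥ (proj₁ (x∈p∩q⁻ ⊥ p i∈))

-- A free `q` contains no separated point at all, so separation inside `q` is automatic.
Completes-nonempty : ∀ {q : Subset n} {π} → Nonempty q →
  Completes r q π ⇔ (Admissible r (q ∷ π) × Free r q)
Completes-nonempty neq = mk⇔
  (λ { ((ne , dj , cov) , sep , free) →
       ((neq ∷ ne , dj , cov) , (λ i _ i<r _ i∈q _ → ⊥-elim (free i i<r i∈q)) ∷ sep) , free })
  (λ { (((_ ∷ ne , dj , cov) , _ ∷ sep) , free) → (ne , dj , cov) , sep , free })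

-- Removal of the least element

S-∑ : ∀ r n k → S r n k ≡ ∑ (choose k (subsets n)) (𝟙 ∘ admissible? r)
S-∑ r n k = length-filter-∑ (admissible? r) (choose k (subsets n))

freeBlocks : ℕ → List (Subset n) → ℕ
freeBlocks r π = ∑ π (𝟙 ∘ free? r)

-- With {0} ∪ q the block of 0, the first summand accounts for q = ∅ and the second for q
-- as a marked block of the remaining partition.
S-suc : ∀ r n k → S (suc r) (suc n) (suc k) ≡
  S r n k + ∑ (choose (suc k) (subsets n)) (λ π → 𝟙 (admissible? r π) * freeBlocks r π)
S-suc r n k = begin
  S (suc r) (suc n) (suc k)
    ≡⟨ S-∑ (suc r) (suc n) (suc k) ⟩
  ∑ (choose (suc k) (subsets (suc n))) f
    -- Exactly one block contains 0: `uncovered` rules out none, `overlapping` rules out two.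
    ≡⟨ ∑-choose-split k (outside ∷_) (inside ∷_) L L f uncovered overlapping ⟩
  ∑ (choose k L) (λ π → ∑ L (λ q → f (map (outside ∷_) π ++ [ inside ∷ q ])))
    ≡⟨ ∑-cong (choose k L) (λ π → ∑-subsets-⊥ n _ (λ q → g q π) (f≡g π) (g-empty π)) ⟩
  ∑ (choose k L) (λ π → f (map (outside ∷_) π ++ [ inside ∷ ⊥ ]) + ∑ L (λ q → g q π))
    ≡⟨ ∑-+ (choose k L) _ _ ⟩
  ∑ (choose k L) (λ π → f (map (outside ∷_) π ++ [ inside ∷ ⊥ ]))
    + ∑ (choose k L) (λ π → ∑ L (λ q → g q π))
    ≡⟨ cong₂ _+_
         (∑-cong (choose k L) (λ π →
           𝟙-⇔ (Completes-⊥ π ⇔-∘ Admissible-++ ⊥ π) (admissible? _ _) (admissible? r π)))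
         (∑-choose-picks k L g g-repeated) ⟩
  ∑ (choose k L) (𝟙 ∘ admissible? r) + ∑ (choose (suc k) L) (λ π → ∑ (picks π) (uncurry g))
    ≡⟨ cong₂ _+_ (sym (S-∑ r n k)) (∑-cong (choose (suc k) L) g-picks) ⟩
  S r n k + ∑ (choose (suc k) L) (λ π → 𝟙 (admissible? r π) * freeBlocks r π) ∎
  where
  L = subsets n
  f : List (Subset (suc n)) → ℕ
  f = 𝟙 ∘ admissible? (suc r)
  g : Subset n → List (Subset n) → ℕ
  g q π = 𝟙 (admissible? r (q ∷ π) ×-dec free? r q)

  uncovered : ∀ π → f (map (outside ∷_) π) ≡ 0
  uncovered π = 𝟙-false (admissible? _ _) λ ((_ , _ , cov) , _) →
    All.All¬⇒¬Any (All.map⁺ (All.universal (λ _ ()) π)) (cov zero)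

  overlapping : ∀ π p q ρ → f (map (outside ∷_) π ++ (inside ∷ p) ∷ (inside ∷ q) ∷ ρ) ≡ 0
  overlapping π p q ρ = 𝟙-false (admissible? _ _) λ ((_ , dj , _) , _) → go π dj
    where
    go : ∀ π → ¬ AllPairs Disjoint (map (outside ∷_) π ++ (inside ∷ p) ∷ (inside ∷ q) ∷ ρ)
    go []      ((d ∷ _) ∷ _) = d (zero , here)
    go (_ ∷ π) (_ ∷ dj)      = go π dj

  f≡g : ∀ π q → Nonempty q → f (map (outside ∷_) π ++ [ inside ∷ q ]) ≡ g q π
  f≡g π q neq = 𝟙-⇔ (Completes-nonempty neq ⇔-∘ Admissible-++ q π) (admissible? _ _)
    (admissible? r (q ∷ π) ×-dec free? r q)

  g-empty : ∀ π q → Empty q → g q π ≡ 0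
  g-empty π q emp = 𝟙-false (admissible? r (q ∷ π) ×-dec free? r q)
    λ { (((ne ∷ _ , _) , _) , _) → emp ne }

  -- A repeated block would be non-empty and disjoint from itself.
  g-repeated : ∀ q π → q ∈ˡ π → g q π ≡ 0
  g-repeated q π q∈π = 𝟙-false (admissible? r (q ∷ π) ×-dec free? r q)
    λ { ((((i , i∈q) ∷ _ , dq ∷ _ , _) , _) , _) → All.lookup dq q∈π (i , x∈p∩q⁺ (i∈q , i∈q)) }

  g-picks : ∀ π → ∑ (picks π) (uncurry g) ≡ 𝟙 (admissible? r π) * freeBlocks r π
  g-picks π = begin
    ∑ (picks π) (uncurry g)
      -- Each pick is a rearrangement of `π`, so the admissibility factor does not depend on the
      -- marked block and leaves the sum.
      ≡⟨ ∑-cong-All (All.map (λ {(q , ρ)} p → ≡.trans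
           (𝟙-× (admissible? r (q ∷ ρ)) (free? r q))
           (cong (_* 𝟙 (free? r q)) (𝟙-⇔ (Admissible-↭ p) (admissible? r (q ∷ ρ)) (admissible? r π))))
           (picks-↭ π)) ⟩
    ∑ (picks π) (λ (q , ρ) → 𝟙 (admissible? r π) * 𝟙 (free? r q))
      ≡⟨ ∑-*ˡ (𝟙 (admissible? r π)) (picks π) (λ (q , ρ) → 𝟙 (free? r q)) ⟩
    𝟙 (admissible? r π) * ∑ (picks π) (λ (q , ρ) → 𝟙 (free? r q))
      ≡⟨ cong (𝟙 (admissible? r π) *_) (∑-picks-proj₁ π (𝟙 ∘ free? r)) ⟩
    𝟙 (admissible? r π) * freeBlocks r π ∎

-- If the number of free blocks is the same for all admissible partitions, the marked sum collapses
-- to a multiple of a Stirling number. This is used for `r` equal to 0 and 1.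
S-suc-const : ∀ r n k c →
  (∀ (π : List (Subset n)) → length π ≡ suc k → Admissible r π → freeBlocks r π ≡ c) →
  S (suc r) (suc n) (suc k) ≡ S r n k + c * S r n (suc k)
S-suc-const r n k c eq = ≡.trans (S-suc r n k) (cong (S r n k +_) (begin
  ∑ (choose (suc k) L) (λ π → 𝟙 (admissible? r π) * freeBlocks r π)
    ≡⟨ ∑-cong-All (All.map (λ {π} len → 𝟙-* (admissible? r π) (eq π len)) (length-choose (suc k) L)) ⟩
  ∑ (choose (suc k) L) (λ π → c * 𝟙 (admissible? r π))
    ≡⟨ ∑-*ˡ c (choose (suc k) L) (𝟙 ∘ admissible? r) ⟩
  c * ∑ (choose (suc k) L) (𝟙 ∘ admissible? r)
    ≡⟨ cong (c *_) (S-∑ r n (suc k)) ⟨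
  c * S r n (suc k) ∎))
  where
  L = subsets n

-- Recurrences for separation of at most two points

freeBlocks-0 : ∀ (π : List (Subset n)) → freeBlocks 0 π ≡ length π
freeBlocks-0 []      = refl
freeBlocks-0 (p ∷ π) = cong₂ _+_ (𝟙-true (free? 0 p) λ _ ()) (freeBlocks-0 π)

zero∉⇒Free1 : {p : Subset (suc n)} → zero ∉ p → Free 1 p
zero∉⇒Free1 0∉p zero    _ = 0∉p
zero∉⇒Free1 0∉p (suc i) (s<s ())

freeBlocks-none : ∀ {π : List (Subset (suc n))} → All (zero ∉_) π → freeBlocks 1 π ≡ length π
freeBlocks-none []          = refl
freeBlocks-none (0∉p ∷ 0∉π) =
  cong₂ _+_ (𝟙-true (free? 1 _) (zero∉⇒Free1 0∉p)) (freeBlocks-none 0∉π)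

-- By disjointness the first point lies in exactly one block, and all the others are free.
freeBlocks-1 : ∀ {π : List (Subset (suc n))} → AllPairs Disjoint π → Any (zero ∈_) π →
               suc (freeBlocks 1 π) ≡ length π
freeBlocks-1 (dp ∷ _) (here 0∈p) = cong suc (cong₂ _+_
  (𝟙-false (free? 1 _) λ free → free zero z<s 0∈p)
  (freeBlocks-none (All.map (λ d 0∈q → d (zero , x∈p∩q⁺ (0∈p , 0∈q))) dp)))
freeBlocks-1 {π = p ∷ π} (dp ∷ dj) (there 0∈π) = begin
  suc (𝟙 (free? 1 p) + freeBlocks 1 π)  ≡⟨ cong (λ c → suc (c + _)) (𝟙-true (free? 1 p) (zero∉⇒Free1 0∉p)) ⟩
  suc (suc (freeBlocks 1 π))            ≡⟨ cong suc (freeBlocks-1 dj 0∈π) ⟩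
  suc (length π)                        ∎
  where
  0∉p : zero ∉ p
  0∉p 0∈p = All.lookupWith (λ d 0∈q → d (zero , x∈p∩q⁺ (0∈p , 0∈q))) dp 0∈π

-- Separating a single point is no restriction. Hence removing the least element, which lowers `r`
-- from 1 to 0, yields a recurrence for `S 0` itself.
S-1≡S-0 : ∀ n k → S 1 n k ≡ S 0 n k
S-1≡S-0 n k = begin
  S 1 n k                                     ≡⟨ S-∑ 1 n k ⟩
  ∑ (choose k (subsets n)) (𝟙 ∘ admissible? 1)
    ≡⟨ ∑-cong (choose k (subsets n)) (λ π → 𝟙-⇔ (iff π) (admissible? 1 π) (admissible? 0 π)) ⟩
  ∑ (choose k (subsets n)) (𝟙 ∘ admissible? 0) ≡⟨ S-∑ 0 n k ⟨
  S 0 n k                                     ∎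
  where
  toℕ<1 : ∀ {n} {i j : Fin n} → toℕ i < 1 → toℕ j < 1 → i ≡ j
  toℕ<1 {i = zero}  {zero}  _        _        = refl
  toℕ<1 {i = suc _} {_}     (s<s ()) _
  toℕ<1 {i = zero}  {suc _} _        (s<s ())

  iff : ∀ π → Admissible 1 π ⇔ Admissible 0 π
  iff π = mk⇔ (map₂ λ _ → All.universal (λ _ _ _ ()) π)
              (map₂ λ _ → All.universal (λ _ _ _ i<1 j<1 _ _ → toℕ<1 i<1 j<1) π)

S₀-suc-suc : ∀ n k → S 0 (suc n) (suc k) ≡ S 0 n k + suc k * S 0 n (suc k)
S₀-suc-suc n k = ≡.trans (sym (S-1≡S-0 (suc n) (suc k)))
  (S-suc-const 0 n k (suc k) λ π len _ → ≡.trans (freeBlocks-0 π) len)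

S₀-suc-0 : ∀ n → S 0 (suc n) 0 ≡ 0
S₀-suc-0 n = ≡.trans (S-∑ 0 (suc n) 0)
  (cong (_+ 0) (𝟙-false (admissible? {suc n} 0 []) λ ((_ , _ , cov) , _) → Any.¬Any[] (cov zero)))

S₀-0-suc : ∀ k → S 0 0 (suc k) ≡ 0
S₀-0-suc zero    = refl
S₀-0-suc (suc k) = refl

-- Of the `suc k` blocks left after the removal, all but the one of the remaining separated point
-- can be marked; the size `suc n` guarantees that this point exists.
S₂-suc : ∀ n k → S 2 (2 + n) (suc k) ≡ S 0 (suc n) k + k * S 0 (suc n) (suc k)
S₂-suc n k = begin
  S 2 (2 + n) (suc k)
    ≡⟨ S-suc-const 1 (suc n) k k (λ { π len ((_ , dj , cov) , _) →
         suc-injective (≡.trans (freeBlocks-1 dj (cov zero)) len) }) ⟩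
  S 1 (suc n) k + k * S 1 (suc n) (suc k)
    ≡⟨ cong₂ (λ a b → a + k * b) (S-1≡S-0 (suc n) k) (S-1≡S-0 (suc n) (suc k)) ⟩
  S 0 (suc n) k + k * S 0 (suc n) (suc k) ∎

-- 2-Fubini numbers

-- The usual triangular recurrence, with `r` fixed at 2. Removing the least element changes `r`, so
-- it is derived algebraically by passing through `S 0`.
S₂-suc-suc : ∀ n k → S 2 (3 + n) (3 + k) ≡ S 2 (2 + n) (2 + k) + (3 + k) * S 2 (2 + n) (3 + k)
S₂-suc-suc n k = begin
  S 2 (3 + n) (3 + k)
    ≡⟨ S₂-suc (suc n) (2 + k) ⟩
  S 0 (2 + n) (2 + k) + (2 + k) * S 0 (2 + n) (3 + k)
    ≡⟨ cong₂ (λ x y → x + (2 + k) * y) (S₀-suc-suc (suc n) (1 + k)) (S₀-suc-suc (suc n) (2 + k)) ⟩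
  a + (2 + k) * b + (2 + k) * (b + (3 + k) * c)
    -- The coefficient of `b` is `2 * (2 + k)`, rewritten as `(1 + k) + (3 + k)`.
    ≡⟨ regroup k a b c ⟩
  a + (1 + k) * b + (3 + k) * (b + (2 + k) * c)
    ≡⟨ cong₂ (λ x y → x + (3 + k) * y) (S₂-suc n (1 + k)) (S₂-suc n (2 + k)) ⟨
  S 2 (2 + n) (2 + k) + (3 + k) * S 2 (2 + n) (3 + k) ∎
  where
  a = S 0 (1 + n) (1 + k)
  b = S 0 (1 + n) (2 + k)
  c = S 0 (1 + n) (3 + k)

  regroup : ∀ k a b c → a + (2 + k) * b + (2 + k) * (b + (3 + k) * c) ≡
                        a + (1 + k) * b + (3 + k) * (b + (2 + k) * c)
  regroup = solve-∀

-- The lower end of the triangular recurrence: two separated points need two blocks, so no term with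
-- one block arises. Here this shows as the vanishing of `S 0 (1 + n) 0`.
S₂-suc-2 : ∀ n → S 2 (3 + n) 2 ≡ 2 * S 2 (2 + n) 2
S₂-suc-2 n = begin
  S 2 (3 + n) 2
    ≡⟨ S₂-suc (suc n) 1 ⟩
  S 0 (2 + n) 1 + 1 * S 0 (2 + n) 2
    ≡⟨ cong₂ (λ x y → x + 1 * y) (S₀-suc-suc (suc n) 0) (S₀-suc-suc (suc n) 1) ⟩
  S 0 (1 + n) 0 + 1 * a + 1 * (a + 2 * b)
    ≡⟨ cong (λ x → x + 1 * a + 1 * (a + 2 * b)) (S₀-suc-0 n) ⟩
  1 * a + 1 * (a + 2 * b)
    ≡⟨ regroup a b ⟩
  2 * (a + 1 * b)
    ≡⟨ cong (2 *_) (S₂-suc n 1) ⟨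
  2 * S 2 (2 + n) 2 ∎
  where
  a = S 0 (1 + n) 1
  b = S 0 (1 + n) 2

  regroup : ∀ a b → 1 * a + 1 * (a + 2 * b) ≡ 2 * (a + 1 * b)
  regroup = solve-∀

S₂-2-suc : ∀ k → S 2 2 (3 + k) ≡ 0
S₂-2-suc k = begin
  S 2 2 (3 + k)                            ≡⟨ S₂-suc 0 (2 + k) ⟩
  S 0 1 (2 + k) + (2 + k) * S 0 1 (3 + k)  ≡⟨ cong₂ (λ x y → x + (2 + k) * y) (S₀-1 k) (S₀-1 (1 + k)) ⟩
  (2 + k) * 0                              ≡⟨ *-zeroʳ (2 + k) ⟩
  0                                        ∎
  where
  S₀-1 : ∀ k → S 0 1 (2 + k) ≡ 0
  S₀-1 k = begin
    S 0 1 (2 + k)                            ≡⟨ S₀-suc-suc 0 (1 + k) ⟩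
    S 0 0 (1 + k) + (2 + k) * S 0 0 (2 + k)  ≡⟨ cong₂ (λ x y → x + (2 + k) * y) (S₀-0-suc k) (S₀-0-suc (1 + k)) ⟩
    (2 + k) * 0                              ≡⟨ *-zeroʳ (2 + k) ⟩
    0                                        ∎

-- (k + 2)! S₂(n + 2, k + 2) in a form that evaluates quickly, unlike the enumeration in S.
summand : ℕ → ℕ → ℕ
summand zero    zero    = 2
summand zero    (suc k) = 0
summand (suc n) zero    = 2 * summand n zero
summand (suc n) (suc k) = (3 + k) * (summand n k + summand n (suc k))

-- Multiplied by `(3 + k) !`, the coefficients 1 and `3 + k` of the recurrence become a common
-- factor `3 + k`, the rest being absorbed by the factorials.
summand-S : ∀ n k → summand n k ≡ (2 + k) ! * S 2 (2 + n) (2 + k)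
summand-S zero    zero    = refl
summand-S zero    (suc k) = sym (≡.trans (cong ((3 + k) ! *_) (S₂-2-suc k)) (*-zeroʳ ((3 + k) !)))
summand-S (suc n) zero    = begin
  2 * summand n zero      ≡⟨ cong (2 *_) (summand-S n zero) ⟩
  2 * (2 * S 2 (2 + n) 2) ≡⟨ cong (2 *_) (S₂-suc-2 n) ⟨
  2 * S 2 (3 + n) 2       ∎
summand-S (suc n) (suc k) = begin
  (3 + k) * (summand n k + summand n (suc k))
    ≡⟨ cong₂ (λ x y → (3 + k) * (x + y)) (summand-S n k) (summand-S n (suc k)) ⟩
  (3 + k) * ((2 + k) ! * a + (3 + k) * (2 + k) ! * b)
    ≡⟨ regroup (3 + k) ((2 + k) !) a b ⟩
  (3 + k) ! * (a + (3 + k) * b)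
    ≡⟨ cong ((3 + k) ! *_) (S₂-suc-suc n k) ⟨
  (3 + k) ! * S 2 (3 + n) (3 + k) ∎
  where
  a = S 2 (2 + n) (2 + k)
  b = S 2 (2 + n) (3 + k)

  regroup : ∀ c f a b → c * (f * a + c * f * b) ≡ c * f * (a + c * b)
  regroup = solve-∀

summand-0 : ∀ {n k} → n < k → summand n k ≡ 0
summand-0 {zero}  {suc k} _         = refl
summand-0 {suc n} {suc k} (s<s n<k) = ≡.trans
  (cong₂ (λ x y → (3 + k) * (x + y)) (summand-0 n<k) (summand-0 (m<n⇒m<1+n n<k)))
  (*-zeroʳ (3 + k))

-- Truncation to six summands modulo 64

∑< : ℕ → (ℕ → ℕ) → ℕ
∑< n f = sum (applyUpTo f n)

∑<-+ : ∀ m n f → ∑< (m + n) f ≡ ∑< m f + ∑< n (f ∘ (m +_))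
∑<-+ zero    n f = refl
∑<-+ (suc m) n f =
  ≡.trans (cong (f 0 +_) (∑<-+ m n (f ∘ suc))) (sym (+-assoc (f 0) _ _))

∑<-∣ : ∀ d n {f} → (∀ k → d ∣ f k) → d ∣ ∑< n f
∑<-∣ d zero    d∣f = d ∣0
∑<-∣ d (suc n) d∣f = ∣m∣n⇒∣m+n (d∣f 0) (∑<-∣ d n (d∣f ∘ suc))

F-summand : ∀ n → F n 2 ≡ ∑< (suc n) (summand n)
F-summand n = ≡.trans
  (cong sum (map-cong (λ k → sym (≡.trans (summand-S n k)
    (cong₂ (λ i j → i ! * S 2 j i) (+-comm 2 k) (+-comm 2 n)))) (upTo (suc n))))
  (cong sum (map-upTo (summand n) (suc n)))

-- The factor `(8 + k) !` is a multiple of `8 !`, which is 64 times 630.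
64∣summand : ∀ n k → 64 ∣ summand n (6 + k)
64∣summand n k = subst (64 ∣_) (sym (summand-S n (6 + k)))
  (∣m⇒∣m*n _ (∣-trans (from-yes (64 ∣? 8 !)) (m≤n⇒m!∣n! (m≤m+n 8 k))))

truncated : ℕ → ℕ
truncated n = ∑< 6 (summand n)

F≡truncated : ∀ n → F n 2 % 64 ≡ truncated n % 64
F≡truncated n = begin
  F n 2 % 64
    -- The sum may have fewer than six terms. Five zero terms are appended, giving length `6 + n`,
    -- so that six can be split off for every `n`.
    ≡⟨ cong (_% 64) (≡.trans (F-summand n) (sym (+-identityʳ _))) ⟩
  (∑< (suc n) (summand n) + 0) % 64
    ≡⟨ cong (λ x → (∑< (suc n) (summand n) + x) % 64) tail-0 ⟨
  (∑< (suc n) (summand n) + ∑< 5 (summand n ∘ (suc n +_))) % 64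
    ≡⟨ cong (_% 64) (∑<-+ (suc n) 5 (summand n)) ⟨
  ∑< (suc n + 5) (summand n) % 64
    ≡⟨ cong (λ N → ∑< N (summand n) % 64) (cong suc (+-comm n 5)) ⟩
  ∑< (6 + n) (summand n) % 64
    ≡⟨ cong (_% 64) (∑<-+ 6 n (summand n)) ⟩
  (truncated n + ∑< n (summand n ∘ (6 +_))) % 64
    ≡⟨ %-remove-+ʳ (truncated n) (∑<-∣ 64 n (64∣summand n)) ⟩
  truncated n % 64 ∎
  where
  tail-0 : ∑< 5 (summand n ∘ (suc n +_)) ≡ 0
  -- Only 0 is divisible by 0, so the divisibility lemma for sums also proves vanishing.
  tail-0 = 0∣⇒≡0 (∑<-∣ 0 5 λ k → subst (0 ∣_) (sym (summand-0 (m≤m+n (suc n) k))) (0 ∣0))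

-- Periodicity modulo 64

+-cong-% : ∀ d .{{_ : NonZero d}} a a′ b b′ → a % d ≡ a′ % d → b % d ≡ b′ % d →
           (a + b) % d ≡ (a′ + b′) % d
+-cong-% d a a′ b b′ a≡ b≡ = begin
  (a + b) % d              ≡⟨ %-distribˡ-+ a b d ⟩
  (a % d + b % d) % d      ≡⟨ cong₂ (λ x y → (x + y) % d) a≡ b≡ ⟩
  (a′ % d + b′ % d) % d    ≡⟨ %-distribˡ-+ a′ b′ d ⟨
  (a′ + b′) % d            ∎

*-congˡ-% : ∀ d .{{_ : NonZero d}} c a a′ → a % d ≡ a′ % d → (c * a) % d ≡ (c * a′) % d
*-congˡ-% d c a a′ a≡ = begin
  (c * a) % d              ≡⟨ %-distribˡ-* c a d ⟩
  (c % d * (a % d)) % d    ≡⟨ cong (λ x → (c % d * x) % d) a≡ ⟩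
  (c % d * (a′ % d)) % d   ≡⟨ %-distribˡ-* c a′ d ⟨
  (c * a′) % d             ∎

-- The first six entries of a row determine those of the next row modulo 64, so the computed
-- agreement of rows 5 and 13 propagates to all later rows.
summand-period : ∀ n {k} → k < 6 → summand (n + 13) k % 64 ≡ summand (n + 5) k % 64
summand-period zero            k<6 =
  from-yes (allUpTo? (λ k → summand 13 k % 64 ≟ summand 5 k % 64) 6) k<6
summand-period (suc n) {zero}  k<6 =
  *-congˡ-% 64 2 (summand (n + 13) 0) (summand (n + 5) 0) (summand-period n k<6)
summand-period (suc n) {suc k} k<6 = *-congˡ-% 64 (3 + k)
  (summand (n + 13) k + summand (n + 13) (suc k)) (summand (n + 5) k + summand (n + 5) (suc k))
  (+-cong-% 64 (summand (n + 13) k) (summand (n + 5) k)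
    (summand (n + 13) (suc k)) (summand (n + 5) (suc k))
    (summand-period n (<-trans (n<1+n k) k<6)) (summand-period n k<6))

∑<-cong-% : ∀ d .{{_ : NonZero d}} n f g → (∀ {k} → k < n → f k % d ≡ g k % d) →
            ∑< n f % d ≡ ∑< n g % d
∑<-cong-% d zero    f g eq = refl
∑<-cong-% d (suc n) f g eq = +-cong-% d (f 0) (g 0) (∑< n (f ∘ suc)) (∑< n (g ∘ suc))
  (eq z<s) (∑<-cong-% d n (f ∘ suc) (g ∘ suc) (λ k<n → eq (s<s k<n)))

truncated-period : ∀ q n → truncated (q * 8 + n + 5) % 64 ≡ truncated (n + 5) % 64
truncated-period zero    n = refl
truncated-period (suc q) n = begin
  truncated (8 + q * 8 + n + 5) % 64  ≡⟨ cong (λ i → truncated i % 64) (regroup (q * 8) n) ⟩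
  truncated (q * 8 + n + 13) % 64     ≡⟨ ∑<-cong-% 64 6 (summand (q * 8 + n + 13)) (summand (q * 8 + n + 5))
                                           (summand-period (q * 8 + n)) ⟩
  truncated (q * 8 + n + 5) % 64      ≡⟨ truncated-period q n ⟩
  truncated (n + 5) % 64              ∎
  where
  regroup : ∀ a n → 8 + a + n + 5 ≡ a + n + 13
  regroup = solve-∀

-- Passage to smaller powers of 2

^-monoʳ-∣ : ∀ b {m n} → m ≤ n → b ^ m ∣ b ^ n
^-monoʳ-∣ b {m} {n} m≤n = subst (b ^ m ∣_)
  (≡.trans (sym (^-distribˡ-+-* b m (n ∸ m))) (cong (b ^_) (m+[n∸m]≡n m≤n)))
  (m∣m*n (b ^ (n ∸ m)))

infixl 7 _%2^_
_%2^_ : ℕ → ℕ → ℕ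
a %2^ m = (a % (2 ^ m)) {{m^n≢0 2 m}}

%2^-≤ : ∀ {m n} a b → m ≤ n → a %2^ n ≡ b %2^ n → a %2^ m ≡ b %2^ m
%2^-≤ {m} {n} a b m≤n eq = begin
  a %2^ m         ≡⟨ reduce a ⟨
  a %2^ n %2^ m   ≡⟨ cong (_%2^ m) eq ⟩
  b %2^ n %2^ m   ≡⟨ reduce b ⟩
  b %2^ m         ∎
  where
  reduce : ∀ a → a %2^ n %2^ m ≡ a %2^ m
  reduce a = m∣n⇒o%n%m≡o%m (2 ^ m) (2 ^ n) a {{m^n≢0 2 m}} {{m^n≢0 2 n}} (^-monoʳ-∣ 2 m≤n)

%⇒mod : ∀ d .{{_ : NonZero d}} a b → a % d ≡ b % d → a ≡ b [mod d ]
%⇒mod d a b eq = ∣⇒∣ᵤ (divides (pos (a / d) ℤ.- pos (b / d)) (begin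
  pos a ℤ.- pos b
    ≡⟨ cong₂ ℤ._-_ (split a) (split b) ⟩
  (pos (a % d) ℤ.+ pos (a / d) ℤ.* pos d) ℤ.- (pos (b % d) ℤ.+ pos (b / d) ℤ.* pos d)
    ≡⟨ cong (λ r → (pos r ℤ.+ pos (a / d) ℤ.* pos d) ℤ.- (pos (b % d) ℤ.+ pos (b / d) ℤ.* pos d)) eq ⟩
  (pos (b % d) ℤ.+ pos (a / d) ℤ.* pos d) ℤ.- (pos (b % d) ℤ.+ pos (b / d) ℤ.* pos d)
    ≡⟨ cancel (pos (b % d)) (pos (a / d)) (pos (b / d)) (pos d) ⟩
  (pos (a / d) ℤ.- pos (b / d)) ℤ.* pos d ∎))
  where
  split : ∀ a → pos a ≡ pos (a % d) ℤ.+ pos (a / d) ℤ.* pos d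
  split a = begin
    pos a                                  ≡⟨ cong pos (m≡m%n+[m/n]*n a d) ⟩
    pos (a % d) ℤ.+ pos (a / d * d)        ≡⟨ cong (ℤ._+_ (pos (a % d))) (ℤ.pos-* (a / d) d) ⟩
    pos (a % d) ℤ.+ pos (a / d) ℤ.* pos d  ∎

  cancel : ∀ r x y d → (r ℤ.+ x ℤ.* d) ℤ.- (r ℤ.+ y ℤ.* d) ≡ (x ℤ.- y) ℤ.* d
  cancel = ℤ.solve-∀

truncated-mod64 : ∀ n → 5 ≤ n → truncated (2 + n) % 64 ≡ truncated n % 64
truncated-mod64 n 5≤n = begin
  truncated (2 + n) % 64                ≡⟨ cong (λ i → truncated (2 + i) % 64) split ⟩
  truncated (2 + (q * 8 + s + 5)) % 64  ≡⟨ cong (λ i → truncated i % 64) (regroup (q * 8) s) ⟩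
  truncated (q * 8 + (2 + s) + 5) % 64  ≡⟨ truncated-period q (2 + s) ⟩
  truncated (2 + s + 5) % 64            ≡⟨ from-yes (allUpTo? period-2? 8) (m%n<n (n ∸ 5) 8) ⟩
  truncated (s + 5) % 64                ≡⟨ truncated-period q s ⟨
  truncated (q * 8 + s + 5) % 64        ≡⟨ cong (λ i → truncated i % 64) split ⟨
  truncated n % 64                      ∎
  where
  q = (n ∸ 5) / 8
  s = (n ∸ 5) % 8

  period-2? : ∀ s → Dec (truncated (2 + s + 5) % 64 ≡ truncated (s + 5) % 64)
  period-2? s = truncated (2 + s + 5) % 64 ≟ truncated (s + 5) % 64

  split : n ≡ q * 8 + s + 5
  split = begin
    n              ≡⟨ m∸n+n≡m 5≤n ⟨
    n ∸ 5 + 5      ≡⟨ cong (_+ 5) (≡.trans (m≡m%n+[m/n]*n (n ∸ 5) 8) (+-comm s (q * 8))) ⟩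
    q * 8 + s + 5  ∎

  regroup : ∀ a s → 2 + (a + s + 5) ≡ a + (2 + s) + 5
  regroup = solve-∀

-- From `n` equal to 5 on, the congruence modulo 64 covers all `m ≤ 6`. For each smaller `n` the
-- largest admissible modulus is `2 ^ suc n`, which is checked by computation and implies the
-- others.
truncated-mod : ∀ m n → m ≤ 6 → m ≤ suc n → truncated (2 + n) %2^ m ≡ truncated n %2^ m
truncated-mod m n m≤6 m≤1+n = [ small , large ]′ (<-≤-connex n 5)
  where
  small : n < 5 → truncated (2 + n) %2^ m ≡ truncated n %2^ m
  small n<5 = %2^-≤ (truncated (2 + n)) (truncated n) m≤1+n
    (from-yes (allUpTo? (λ n → truncated (2 + n) %2^ suc n ≟ truncated n %2^ suc n) 5) n<5)

  large : 5 ≤ n → truncated (2 + n) %2^ m ≡ truncated n %2^ m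
  large 5≤n = %2^-≤ (truncated (2 + n)) (truncated n) m≤6 (truncated-mod64 n 5≤n)

theorem4p1 : (m : ℕ) → 3 ≤ m → m ≤ 6 →
    (n : ℕ) → m ∸ 1 ≤ n → F (n + 2) 2 ≡ F n 2 [mod 2 ^ m ]
theorem4p1 m _ m≤6 n m-1≤n = %⇒mod (2 ^ m) {{m^n≢0 2 m}} (F (n + 2) 2) (F n 2) (begin
  F (n + 2) 2 %2^ m        ≡⟨ cong (λ i → F i 2 %2^ m) (+-comm n 2) ⟩
  F (2 + n) 2 %2^ m        ≡⟨ %2^-≤ (F (2 + n) 2) (truncated (2 + n)) m≤6 (F≡truncated (2 + n)) ⟩
  truncated (2 + n) %2^ m  ≡⟨ truncated-mod m n m≤6 (≤-trans (m≤n+m∸n m 1) (s≤s m-1≤n)) ⟩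
  truncated n %2^ m        ≡⟨ %2^-≤ (F n 2) (truncated n) m≤6 (F≡truncated n) ⟨
  F n 2 %2^ m              ∎)
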